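{- A one-pass stream algorithm that tests whether $\min_{\mathcal C}\mathrm{disagree}(G,\mathcal C)=0$ (minimum over all partitions $\mathcal C$ of the node set), with probability at least $9/10$, for graphs $G$ on $n$ nodes, requires $\Omega(n+|E^-|)$ bits of space if permitted weights are $\{ -1,0,1\}$.
   Context: Correlation clustering: a weighted graph $G$ on a node set $V$ with $|V|=n$ assigns a weight $w_{uv}$ to each unordered pair $uv$ of distinct nodes (here each weight is in $\{ -1,0,1\}$; pairs not occurring in the stream have weight $0$ and are regarded as non-edges). $E^-=\{uv: w_{uv}<0\}$ is the set of negative edges; the lower bound applies to the setting in which the number of negative edges is bounded, and is expressed in terms of $n$ and $|E^-|$. A clustering is a partition $\mathcal C$ of $V$. A pair $uv$ disagrees with $\mathcal C$ if either $w_{uv}>0$ and $u,v$ are in different clusters, or $w_{uv}<0$ and $u,v$ are in the same cluster. $\mathrm{disagree}(G,\mathcal C)$ is the sum of $|w_{uv}|$ over pairs that disagree with $\mathcal C$. Streaming model: the input is a sequence of edges with their weights, in arbitrary order, read once. Algorithms may be randomized and must be correct with probability at least $9/10$ on every input. The space is the number of bits of memory used. -}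

module Defs where

open import Data.Bool.Base using (Bool; true; false)
import Data.Bool.Properties as Bool
open import Data.Fin.Base using (Fin)
import Data.Fin.Properties as Fin
open import Data.Integer.Base as ℤ using (ℤ; +_; 0ℤ; 1ℤ; -1ℤ; ∣_∣)
import Data.Integer.Properties as ℤ
open import Data.List.Base using (List; []; _∷_; allFin; cartesianProduct; filter; length; map)
open import Data.List.Membership.Propositional using (_∈_)
open import Data.List.Relation.Binary.Permutation.Propositional using (_↭_)
open import Data.Nat.Base using (ℕ; zero; suc; _≤_; NonZero)
open import Data.Nat.ListAction using (sum)
open import Data.Product.Base using (_×_; _,_; ∃-syntax)
open import Data.Rational.Unnormalised.Base as ℚᵘ using (ℚᵘ; _/_)
open import Data.Sum.Base using (_⊎_)
open import Data.Vec.Base using (Vec)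
open import Level using (0ℓ)
open import Relation.Binary.Core using (Rel)
open import Relation.Binary.PropositionalEquality using (_≡_)
open import Relation.Binary.Structures using (IsDecEquivalence)
open import Relation.Nullary using (¬_; Dec)
open import Relation.Nullary.Decidable using (¬?; _×-dec_; _⊎-dec_)

-- An unordered pair of distinct nodes is represented by its increasing
-- ordering.
pairs : ∀ n → List (Fin n × Fin n)
pairs n = filter (λ (u , v) → u Fin.<? v) (cartesianProduct (allFin n) (allFin n))

-- The diagonal of `weight` carries no information: every quantity below
-- only looks at `pairs n`.
record Graph (n : ℕ) : Set where
  field
    weight    : Fin n → Fin n → ℤ
    symmetric : ∀ u v → weight u v ≡ weight v u

open Graph public

WeightsIn : ∀ {n} → List ℤ → Graph n → Set
WeightsIn W G = ∀ u v → weight G u v ∈ W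

E⁻ : ∀ {n} → Graph n → List (Fin n × Fin n)
E⁻ {n} G = filter (λ (u , v) → weight G u v ℤ.<? 0ℤ) (pairs n)

-- A partition of the node set, given by its "same cluster" relation.
-- Decidability makes `disagree` computable; classically it excludes nothing.
record Clustering (n : ℕ) : Set₁ where
  field
    _~_              : Rel (Fin n) 0ℓ
    isDecEquivalence : IsDecEquivalence _~_

  open IsDecEquivalence isDecEquivalence public using () renaming (_≟_ to _~?_)

Disagrees : ∀ {n} → Graph n → Clustering n → Fin n × Fin n → Set
Disagrees G 𝒞 (u , v) =
  (0ℤ ℤ.< weight G u v × ¬ (u ~ v)) ⊎ (weight G u v ℤ.< 0ℤ × u ~ v)
  where open Clustering 𝒞

disagrees? : ∀ {n} (G : Graph n) (𝒞 : Clustering n) p → Dec (Disagrees G 𝒞 p)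
disagrees? G 𝒞 (u , v) =
  (0ℤ ℤ.<? weight G u v ×-dec ¬? (u ~? v)) ⊎-dec (weight G u v ℤ.<? 0ℤ ×-dec (u ~? v))
  where open Clustering 𝒞

disagree : ∀ {n} → Graph n → Clustering n → ℕ
disagree {n} G 𝒞 =
  sum (map (λ (u , v) → ∣ weight G u v ∣) (filter (disagrees? G 𝒞) (pairs n)))

-- min over 𝒞 of disagree G 𝒞 equals k.
MinDisagree≡ : ∀ {n} → Graph n → ℕ → Set₁
MinDisagree≡ {n} G k =
  (∃[ 𝒞 ] disagree G 𝒞 ≡ k) × (∀ (𝒞 : Clustering n) → k ≤ disagree G 𝒞)

Edge : ℕ → Set
Edge n = Fin n × Fin n × ℤ

edges : ∀ {n} → Graph n → List (Edge n)
edges {n} G =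
  map (λ (u , v) → u , v , weight G u v)
      (filter (λ (u , v) → ¬? (weight G u v ℤ.≟ 0ℤ)) (pairs n))

-- `xs` lists the edges of `G` exactly once each, in arbitrary order.
_Streams_ : ∀ {n} → List (Edge n) → Graph n → Set
xs Streams G = xs ↭ edges G

-- A deterministic one-pass algorithm with `s` bits of memory.  The first
-- argument of `step` is the number of edges read so far; it is not charged
-- to the memory.
record Deterministic (n s : ℕ) : Set where
  field
    init   : Vec Bool s
    step   : ℕ → Edge n → Vec Bool s → Vec Bool s
    output : Vec Bool s → Bool

  process : ℕ → List (Edge n) → Vec Bool s → Vec Bool s
  process t []       μ = μ
  process t (x ∷ xs) μ = process (suc t) xs (step t x μ)

  run : List (Edge n) → Bool
  run xs = output (process 0 xs init)

-- A random choice, uniform over finitely many seeds, of a deterministic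
-- algorithm; the seed is not charged to the memory.  Repeated entries give
-- arbitrary rational probabilities, and since `step` sees the time, drawing
-- fresh independent coins at every step is a special case.
record Randomized (n s : ℕ) : Set where
  field
    seeds         : ℕ
    {{seeds≢0}}   : NonZero seeds
    deterministic : Fin seeds → Deterministic n s

Pr[_on_outputs_] : ∀ {n s} → Randomized n s → List (Edge n) → Bool → ℚᵘ
Pr[ A on xs outputs b ] =
  + length (filter (λ ω → Deterministic.run (deterministic ω) xs Bool.≟ b) (allFin seeds)) / seeds
  where open Randomized A

-- With probability at least 9/10 on every input with at most `m` negative
-- edges, `A` decides whether the minimum disagreement is zero.
TestsZeroDisagreement : ∀ {n s} → ℕ → Randomized n s → Set₁
TestsZeroDisagreement {n} m A =
  ∀ (G : Graph n) → WeightsIn (-1ℤ ∷ 0ℤ ∷ 1ℤ ∷ []) G → length (E⁻ G) ≤ m →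
  ∀ (xs : List (Edge n)) → xs Streams G →
    (MinDisagree≡ G 0 → + 9 / 10 ℚᵘ.≤ Pr[ A on xs outputs true ]) ×
    (¬ MinDisagree≡ G 0 → + 9 / 10 ℚᵘ.≤ Pr[ A on xs outputs false ])

{-# OPTIONS --safe #-}
module Submission where

-- Reduction from the one-way communication problem INDEX.  Alice streams one
-- edge (a i , b j xᵢⱼ) of sign σ for each of her bits x i j; to ask for one bit,
-- Bob joins a new node w to a i by a positive edge and to b j false by an edge
-- of sign − σ.  If the bit is false this closes a triangle with exactly one
-- negative edge, which every clustering violates; otherwise the endpoints of
-- the positive edges form a cluster violating nothing.  With σ = − this carries
-- Ω(min(m , n²)) bits, with σ = + and a single row Ω(n) bits and only one
-- negative edge.  The memory state after Alice's edges therefore lets Bob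
-- recover each bit with probability 9/10, which forces it to be linear in the
-- number of bits.

open import Data.Bool.Base using (Bool; true; false; if_then_else_)
import Data.Bool.Properties as Bool
open import Data.Fin.Base as Fin using (Fin; zero; suc; inject≤; combine; remQuot; _↑ˡ_; _↑ʳ_)
import Data.Fin.Properties as Fin
open import Data.Integer.Base as ℤ using (ℤ; 0ℤ; 1ℤ; -1ℤ; _◃_)
import Data.Integer.Properties as ℤ
open import Data.List.Base using (List; []; _∷_; _++_; allFin; cartesianProduct; filter; length; map; tabulate)
import Data.List.Membership.DecPropositional as DecMembership
open import Data.List.Membership.Propositional using (_∈_)
open import Data.List.Membership.Propositional.Properties
open import Data.List.Membership.Propositional.Properties.WithK using (unique∧set⇒bag)
open import Data.List.Properties using (length-++; length-map; length-tabulate; length-filter; map-++; map-tabulate; filter-++; filter-none; ++-identityʳ)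
open import Data.List.Relation.Binary.BagAndSetEquality using (∼bag⇒↭)
open import Data.List.Relation.Binary.Permutation.Propositional.Properties using (↭-length)
open import Data.List.Relation.Unary.All as All using (All; []; _∷_)
import Data.List.Relation.Unary.All.Properties as All
open import Data.List.Relation.Unary.AllPairs using ([]; _∷_)
import Data.List.Relation.Unary.AllPairs.Properties as AllPairs
open import Data.List.Relation.Unary.Any using (here; there)
open import Data.List.Relation.Unary.Unique.Propositional using (Unique)
import Data.List.Relation.Unary.Unique.Propositional.Properties as Unique
open import Data.Nat using (ℕ; zero; suc; _+_; _*_; _^_; _⊓_; _≤_; _<_; _≤?_; z≤n; s≤s; NonZero; >-nonZero)
open import Data.Nat.Combinatorics using (_C_; nC1≡n; nCk+nC[k+1]≡[n+1]C[k+1])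
open import Data.Nat.DivMod using (_/_; _%_; m/n*n≤m; m≥n⇒m/n>0; m≡m%n+[m/n]*n; m%n<n)
open import Data.Nat.ListAction using (sum)
open import Data.Nat.Properties
open import Data.Nat.Tactic.RingSolver using (solve-∀)
open import Data.Product using (_×_; _,_; proj₁; proj₂; ∃-syntax)
open import Data.Product.Properties using (,-injectiveˡ; ,-injectiveʳ)
import Data.Rational.Unnormalised.Base as ℚᵘ
open import Data.Sign.Base as Sign using (Sign)
open import Data.Sum.Base as Sum using (_⊎_; inj₁; inj₂)
open import Data.Vec.Base using (Vec; []; _∷_; lookup)
open import Defs
open import Function.Base using (_∘_)
open import Function.Bundles using (mk⇔)
open import Level using (Level)
import Relation.Binary.Construct.On as On
open import Relation.Binary.PropositionalEquality
open import Relation.Binary.PropositionalEquality.Properties using (isDecEquivalence)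
open import Relation.Binary.Structures using (IsDecEquivalence)
open import Relation.Nullary using (¬_; Dec; yes; no; does; contradiction)
open import Relation.Nullary.Decidable using (¬?; _×-dec_; _⊎-dec_; decidable-stable; from-yes)
open import Relation.Unary using (Decidable)

private variable
  ℓ : Level
  A B : Set ℓ
  n : ℕ

-- Finite sums over lists.

∑ : List A → (A → ℕ) → ℕ
∑ []       f = 0
∑ (x ∷ xs) f = f x + ∑ xs f

∑-cong : ∀ (xs : List A) {f g : A → ℕ} → (∀ x → f x ≡ g x) → ∑ xs f ≡ ∑ xs g
∑-cong []       f≗g = refl
∑-cong (x ∷ xs) f≗g = cong₂ _+_ (f≗g x) (∑-cong xs f≗g)

∑-mono : ∀ (xs : List A) {f g : A → ℕ} → (∀ x → f x ≤ g x) → ∑ xs f ≤ ∑ xs g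
∑-mono []       f≤g = z≤n
∑-mono (x ∷ xs) f≤g = +-mono-≤ (f≤g x) (∑-mono xs f≤g)

∑-+ : ∀ (xs : List A) (f g : A → ℕ) → ∑ xs (λ x → f x + g x) ≡ ∑ xs f + ∑ xs g
∑-+ []       f g = refl
∑-+ (x ∷ xs) f g = trans (cong (f x + g x +_) (∑-+ xs f g)) (interchange (f x) (g x) _ _)
  where
  interchange : ∀ a b c d → a + b + (c + d) ≡ a + c + (b + d)
  interchange = solve-∀

∑-*ˡ : ∀ (xs : List A) c (f : A → ℕ) → ∑ xs (λ x → c * f x) ≡ c * ∑ xs f
∑-*ˡ []       c f = sym (*-zeroʳ c)
∑-*ˡ (x ∷ xs) c f = trans (cong (c * f x +_) (∑-*ˡ xs c f)) (sym (*-distribˡ-+ c (f x) _))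

∑-const : ∀ (xs : List A) c → ∑ xs (λ _ → c) ≡ length xs * c
∑-const []       c = refl
∑-const (x ∷ xs) c = cong (c +_) (∑-const xs c)

∑-++ : ∀ (xs ys : List A) (f : A → ℕ) → ∑ (xs ++ ys) f ≡ ∑ xs f + ∑ ys f
∑-++ []       ys f = refl
∑-++ (x ∷ xs) ys f = trans (cong (f x +_) (∑-++ xs ys f)) (sym (+-assoc (f x) _ _))

∑-map : ∀ (h : A → B) (xs : List A) (f : B → ℕ) → ∑ (map h xs) f ≡ ∑ xs (λ x → f (h x))
∑-map h []       f = refl
∑-map h (x ∷ xs) f = cong (f (h x) +_) (∑-map h xs f)

∑-swap : ∀ (xs : List A) (ys : List B) (f : A → B → ℕ) →
         ∑ xs (λ x → ∑ ys (f x)) ≡ ∑ ys (λ y → ∑ xs (λ x → f x y))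
∑-swap []       ys f = sym (trans (∑-const ys 0) (*-zeroʳ (length ys)))
∑-swap (x ∷ xs) ys f = trans (cong (∑ ys (f x) +_) (∑-swap xs ys f)) (sym (∑-+ ys (f x) _))

term≤∑ : ∀ {xs : List A} {x} (f : A → ℕ) → x ∈ xs → f x ≤ ∑ xs f
term≤∑ f (here refl)            = m≤m+n _ _
term≤∑ f (there {x = y} x∈xs) = ≤-trans (term≤∑ f x∈xs) (m≤n+m _ (f y))

∑-allFin-suc : ∀ N (f : Fin (suc N) → ℕ) →
               ∑ (allFin (suc N)) f ≡ f zero + ∑ (allFin N) (λ t → f (suc t))
∑-allFin-suc N f = cong (f zero +_)
  (trans (cong (λ ts → ∑ ts f) (sym (map-tabulate (λ t → t) suc))) (∑-map suc (allFin N) f))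

∣allFin∣ : ∀ N → length (allFin N) ≡ N
∣allFin∣ N = length-tabulate (λ t → t)

-- Hits and misses of a guess over the Boolean cube.

hit miss : Bool → Bool → ℕ
hit false false = 1
hit true  true  = 1
hit _     _     = 0
miss false true  = 1
miss true  false = 1
miss _     _     = 0

hit+miss : ∀ β γ → hit β γ + miss β γ ≡ 1
hit+miss false false = refl
hit+miss false true  = refl
hit+miss true  false = refl
hit+miss true  true  = refl

length-filter-≟ : ∀ (xs : List A) (f : A → Bool) β →
                  length (filter (λ x → f x Bool.≟ β) xs) ≡ ∑ xs (λ x → hit (f x) β)
length-filter-≟ []       f β = refl
length-filter-≟ (x ∷ xs) f β with f x | β
... | false | false = cong suc (length-filter-≟ xs f false)
... | false | true  = length-filter-≟ xs f true
... | true  | false = length-filter-≟ xs f false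
... | true  | true  = cong suc (length-filter-≟ xs f true)

cube : ∀ N → List (Vec Bool N)
cube zero    = [] ∷ []
cube (suc N) = map (false ∷_) (cube N) ++ map (true ∷_) (cube N)

∈-cube : ∀ {N} (x : Vec Bool N) → x ∈ cube N
∈-cube []          = here refl
∈-cube (false ∷ x) = ∈-++⁺ˡ (∈-map⁺ (false ∷_) (∈-cube x))
∈-cube (true  ∷ x) = ∈-++⁺ʳ (map (false ∷_) (cube _)) (∈-map⁺ (true ∷_) (∈-cube x))

∣cube∣ : ∀ N → length (cube N) ≡ 2 ^ N
∣cube∣ zero    = refl
∣cube∣ (suc N) = begin
  length (map (false ∷_) (cube N) ++ map (true ∷_) (cube N))         ≡⟨ length-++ (map (false ∷_) (cube N)) ⟩
  length (map (false ∷_) (cube N)) + length (map (true ∷_) (cube N)) ≡⟨ cong₂ _+_ (length-map _ (cube N)) (length-map _ (cube N)) ⟩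
  length (cube N) + length (cube N)                                  ≡⟨ cong₂ _+_ (∣cube∣ N) (∣cube∣ N) ⟩
  2 ^ N + 2 ^ N                                                      ≡⟨ cong (2 ^ N +_) (+-identityʳ (2 ^ N)) ⟨
  2 ^ suc N                                                          ∎
  where open ≡-Reasoning

hits misses : ∀ {N} → (Fin N → Bool) → Vec Bool N → ℕ
hits   {N} g x = ∑ (allFin N) (λ t → hit  (g t) (lookup x t))
misses {N} g x = ∑ (allFin N) (λ t → miss (g t) (lookup x t))

hits+misses : ∀ {N} (g : Fin N → Bool) x → hits g x + misses g x ≡ N
hits+misses {N} g x = begin
  hits g x + misses g x                                                    ≡⟨ ∑-+ (allFin N) _ _ ⟨
  ∑ (allFin N) (λ t → hit (g t) (lookup x t) + miss (g t) (lookup x t))   ≡⟨ ∑-cong (allFin N) (λ t → hit+miss (g t) (lookup x t)) ⟩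
  ∑ (allFin N) (λ _ → 1)                                                   ≡⟨ ∑-const (allFin N) 1 ⟩
  length (allFin N) * 1                                                    ≡⟨ *-identityʳ _ ⟩
  length (allFin N)                                                        ≡⟨ ∣allFin∣ N ⟩
  N                                                                        ∎
  where open ≡-Reasoning

-- The sum factors over coordinates: at each one the two possible bits contribute 2 and 1, whatever
-- the guess. Hence every message gives the same value.
∑2^hits : ∀ N (g : Fin N → Bool) → ∑ (cube N) (λ x → 2 ^ hits g x) ≡ 3 ^ N
∑2^hits zero    g = refl
∑2^hits (suc N) g = begin
  ∑ (cube (suc N)) (λ x → 2 ^ hits g x)
    ≡⟨ ∑-++ (map (false ∷_) (cube N)) _ _ ⟩
  ∑ (map (false ∷_) (cube N)) (λ x → 2 ^ hits g x) + ∑ (map (true ∷_) (cube N)) (λ x → 2 ^ hits g x)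
    ≡⟨ cong₂ _+_ (half false) (half true) ⟩
  2 ^ hit (g zero) false * 3 ^ N + 2 ^ hit (g zero) true * 3 ^ N
    ≡⟨ *-distribʳ-+ (3 ^ N) (2 ^ hit (g zero) false) _ ⟨
  (2 ^ hit (g zero) false + 2 ^ hit (g zero) true) * 3 ^ N
    ≡⟨ cong (_* 3 ^ N) (head (g zero)) ⟩
  3 ^ suc N ∎
  where
  open ≡-Reasoning
  g′ : Fin N → Bool
  g′ t = g (suc t)
  head : ∀ γ → 2 ^ hit γ false + 2 ^ hit γ true ≡ 3
  head false = refl
  head true  = refl
  half : ∀ β → ∑ (map (β ∷_) (cube N)) (λ x → 2 ^ hits g x) ≡ 2 ^ hit (g zero) β * 3 ^ N
  half β = begin
    ∑ (map (β ∷_) (cube N)) (λ x → 2 ^ hits g x)            ≡⟨ ∑-map (β ∷_) (cube N) _ ⟩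
    ∑ (cube N) (λ x → 2 ^ hits g (β ∷ x))                   ≡⟨ ∑-cong (cube N) (λ x → trans (cong (2 ^_) (∑-allFin-suc N (λ t → hit (g t) (lookup (β ∷ x) t)))) (^-distribˡ-+-* 2 (hit (g zero) β) (hits g′ x))) ⟩
    ∑ (cube N) (λ x → 2 ^ hit (g zero) β * 2 ^ hits g′ x)   ≡⟨ ∑-*ˡ (cube N) (2 ^ hit (g zero) β) _ ⟩
    2 ^ hit (g zero) β * ∑ (cube N) (λ x → 2 ^ hits g′ x)   ≡⟨ cong (2 ^ hit (g zero) β *_) (∑2^hits N g′) ⟩
    2 ^ hit (g zero) β * 3 ^ N                              ∎

-- Convexity estimates and the lower bound for INDEX.

2+n≤2*2^n : ∀ n → 2 + n ≤ 2 * 2 ^ n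
2+n≤2*2^n zero    = ≤-refl
2+n≤2*2^n (suc n) = begin
  2 + suc n             ≤⟨ +-mono-≤ (m^n>0 2 (suc n)) (2+n≤2*2^n n) ⟩
  2 ^ suc n + 2 ^ suc n ≡⟨ cong (2 ^ suc n +_) (+-identityʳ _) ⟨
  2 * 2 ^ suc n         ∎
  where open ≤-Reasoning

^-distribʳ-* : ∀ n a b → (a * b) ^ n ≡ a ^ n * b ^ n
^-distribʳ-* zero    a b = refl
^-distribʳ-* (suc n) a b = trans (cong (a * b *_) (^-distribʳ-* n a b)) (interchange a b (a ^ n) (b ^ n))
  where
  interchange : ∀ a b c d → a * b * (c * d) ≡ a * c * (b * d)
  interchange = solve-∀

-- The tangent to 2 ^ (c + k ∸ d) at d = k, without subtraction.
tangent : ∀ a d c k → a + d ≡ c + k → 2 ^ c * (2 + k) ≤ 2 * 2 ^ a + 2 ^ c * d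
tangent a d c k eq with ≤-<-connex d k
... | inj₁ d≤k with e , refl ← m≤n⇒∃[o]m+o≡n d≤k = begin
  2 ^ c * (2 + (d + e))           ≡⟨ split (2 ^ c) d e ⟩
  2 ^ c * (2 + e) + 2 ^ c * d     ≤⟨ +-monoˡ-≤ _ (*-monoʳ-≤ (2 ^ c) (2+n≤2*2^n e)) ⟩
  2 ^ c * (2 * 2 ^ e) + 2 ^ c * d ≡⟨ cong (_+ 2 ^ c * d) (assoc (2 ^ c) (2 ^ e)) ⟩
  2 * (2 ^ c * 2 ^ e) + 2 ^ c * d ≡⟨ cong (λ z → 2 * z + 2 ^ c * d) (^-distribˡ-+-* 2 c e) ⟨
  2 * 2 ^ (c + e) + 2 ^ c * d     ≡⟨ cong (λ z → 2 * 2 ^ z + 2 ^ c * d) a≡c+e ⟨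
  2 * 2 ^ a + 2 ^ c * d           ∎
  where
  open ≤-Reasoning
  split : ∀ z d e → z * (2 + (d + e)) ≡ z * (2 + e) + z * d
  split = solve-∀
  assoc : ∀ z e → z * (2 * e) ≡ 2 * (z * e)
  assoc = solve-∀
  a≡c+e : a ≡ c + e
  a≡c+e = +-cancelʳ-≡ d a (c + e) (trans eq (trans (cong (c +_) (+-comm d e)) (sym (+-assoc c e d))))
-- At d = k + 1 the line meets the curve exactly; beyond that its value is no longer positive, and
-- the term `2 ^ c * d` alone suffices.
... | inj₂ k<d with m≤n⇒∃[o]m+o≡n k<d
...   | zero , refl = begin
  2 ^ c * (2 + k)                       ≡⟨ split (2 ^ c) k ⟩
  2 ^ c + 2 ^ c * (suc k + 0)           ≡⟨ cong (λ z → 2 ^ z + 2 ^ c * (suc k + 0)) c≡1+a ⟩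
  2 * 2 ^ a + 2 ^ c * (suc k + 0)       ∎
  where
  open ≤-Reasoning
  split : ∀ z k → z * (2 + k) ≡ z + z * (suc k + 0)
  split = solve-∀
  c≡1+a : c ≡ suc a
  c≡1+a = sym (+-cancelʳ-≡ k (suc a) c (trans (trans (sym (+-suc a k)) (cong (λ z → a + suc z) (sym (+-identityʳ k)))) eq))
...   | suc e , refl = begin
  2 ^ c * (2 + k)                         ≤⟨ *-monoʳ-≤ (2 ^ c) (s≤s (≤-trans (m≤m+n (suc k) e) (≤-reflexive (sym (+-suc k e))))) ⟩
  2 ^ c * (suc k + suc e)                 ≤⟨ m≤n+m _ (2 * 2 ^ a) ⟩
  2 * 2 ^ a + 2 ^ c * (suc k + suc e)     ∎
  where open ≤-Reasoning

-- Average 2 ^ hits over seeds and strings: by convexity this is at least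
-- 2 ^ 9k, and since a decoder sees only one of 2 ^ s messages it is at most
-- 2 ^ s * (3 / 2) ^ 10k.  Now use 2 ^ 3 * 3 ^ 10 ≤ 2 ^ 19.
index-lower-bound :
  ∀ {N s} k S .{{_ : NonZero S}} → N ≡ 10 * k →
  (encode : Fin S → Vec Bool N → Vec Bool s) (decode : Fin S → Vec Bool s → Fin N → Bool) →
  (∀ x t → 9 * S ≤ 10 * ∑ (allFin S) (λ ω → hit (decode ω (encode ω x) t) (lookup x t))) →
  3 * k ≤ s
index-lower-bound {N} {s} k S N≡10k encode decode good =
  ≮⇒≥ λ s<3k → <⇒≱ (^-monoʳ-< 2 ≤-refl s<3k) 2^3k≤2^s
  where
  open ≤-Reasoning

  guess : Fin S → Vec Bool N → Fin N → Bool
  guess ω x = decode ω (encode ω x)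

  total : (Fin S → Vec Bool N → ℕ) → ℕ
  total f = ∑ (allFin S) (λ ω → ∑ (cube N) (f ω))

  total-const : ∀ c → total (λ _ _ → c) ≡ S * (2 ^ N * c)
  total-const c = begin-equality
    ∑ (allFin S) (λ _ → ∑ (cube N) (λ _ → c)) ≡⟨ ∑-const (allFin S) _ ⟩
    length (allFin S) * ∑ (cube N) (λ _ → c)  ≡⟨ cong₂ _*_ (∣allFin∣ S) (trans (∑-const (cube N) c) (cong (_* c) (∣cube∣ N))) ⟩
    S * (2 ^ N * c)                           ∎

  total-*ˡ : ∀ c f → total (λ ω x → c * f ω x) ≡ c * total f
  total-*ˡ c f = trans (∑-cong (allFin S) (λ ω → ∑-*ˡ (cube N) c (f ω))) (∑-*ˡ (allFin S) c _)

  total-+ : ∀ f g → total (λ ω x → f ω x + g ω x) ≡ total f + total g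
  total-+ f g = trans (∑-cong (allFin S) (λ ω → ∑-+ (cube N) (f ω) (g ω))) (∑-+ (allFin S) _ _)

  few-misses : ∀ x t → 10 * ∑ (allFin S) (λ ω → miss (guess ω x t) (lookup x t)) ≤ S
  few-misses x t = +-cancelˡ-≤ (9 * S) _ _ (begin
    9 * S + 10 * M  ≤⟨ +-monoˡ-≤ (10 * M) (good x t) ⟩
    10 * H + 10 * M ≡⟨ *-distribˡ-+ 10 H M ⟨
    10 * (H + M)    ≡⟨ cong (10 *_) H+M≡S ⟩
    10 * S          ≡⟨ +-comm S (9 * S) ⟩
    9 * S + S       ∎)
    where
    H M : ℕ
    H = ∑ (allFin S) (λ ω → hit  (guess ω x t) (lookup x t))
    M = ∑ (allFin S) (λ ω → miss (guess ω x t) (lookup x t))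
    H+M≡S : H + M ≡ S
    H+M≡S = begin-equality
      H + M                  ≡⟨ ∑-+ (allFin S) _ _ ⟨
      ∑ (allFin S) _         ≡⟨ ∑-cong (allFin S) (λ ω → hit+miss (guess ω x t) (lookup x t)) ⟩
      ∑ (allFin S) (λ _ → 1) ≡⟨ ∑-const (allFin S) 1 ⟩
      length (allFin S) * 1  ≡⟨ *-identityʳ _ ⟩
      length (allFin S)      ≡⟨ ∣allFin∣ S ⟩
      S                      ∎

  -- Exchanging the sums brings the seeds innermost, where `few-misses` applies bit by bit. As N =
  -- 10k, the average number of misses is at most k, the point of tangency.
  total-misses : total (λ ω x → misses (guess ω x) x) ≤ S * (2 ^ N * k)
  total-misses = *-cancelˡ-≤ 10 (begin
    10 * total (λ ω x → misses (guess ω x) x)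
      ≡⟨ cong (10 *_) (∑-swap (allFin S) (cube N) _) ⟩
    10 * ∑ (cube N) (λ x → ∑ (allFin S) (λ ω → misses (guess ω x) x))
      ≡⟨ cong (10 *_) (∑-cong (cube N) (λ x → ∑-swap (allFin S) (allFin N) _)) ⟩
    10 * ∑ (cube N) (λ x → ∑ (allFin N) (λ t → ∑ (allFin S) (λ ω → miss (guess ω x t) (lookup x t))))
      ≡⟨ ∑-*ˡ (cube N) 10 _ ⟨
    ∑ (cube N) (λ x → 10 * ∑ (allFin N) (λ t → ∑ (allFin S) (λ ω → miss (guess ω x t) (lookup x t))))
      ≡⟨ ∑-cong (cube N) (λ x → ∑-*ˡ (allFin N) 10 _) ⟨
    ∑ (cube N) (λ x → ∑ (allFin N) (λ t → 10 * ∑ (allFin S) (λ ω → miss (guess ω x t) (lookup x t))))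
      ≤⟨ ∑-mono (cube N) (λ x → ∑-mono (allFin N) (few-misses x)) ⟩
    ∑ (cube N) (λ x → ∑ (allFin N) (λ t → S))
      ≡⟨ ∑-const (cube N) _ ⟩
    length (cube N) * ∑ (allFin N) (λ t → S)
      ≡⟨ cong₂ _*_ (∣cube∣ N) (trans (∑-const (allFin N) S) (cong (_* S) (trans (∣allFin∣ N) N≡10k))) ⟩
    2 ^ N * (10 * k * S)
      ≡⟨ rearrange (2 ^ N) k S ⟩
    10 * (S * (2 ^ N * k)) ∎)
    where
    rearrange : ∀ c k S → c * (10 * k * S) ≡ 10 * (S * (c * k))
    rearrange = solve-∀

  -- The value of `2 ^ hits` at the point of tangency, with 9k hits and k misses.
  c : ℕ
  c = 2 ^ (9 * k)

  X : ℕ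
  X = total (λ ω x → 2 ^ hits (guess ω x) x)

  -- Jensen's inequality by hand: the tangent bound is summed, and its linear term is at most what k
  -- misses everywhere would give. That amount is added to both sides to avoid subtraction.
  lower : S * (2 ^ N * c) ≤ X
  lower = *-cancelˡ-≤ 2 (+-cancelʳ-≤ (c * (S * (2 ^ N * k))) _ _ (begin
    2 * (S * (2 ^ N * c)) + c * (S * (2 ^ N * k))
      ≡⟨ rearrange S (2 ^ N) c k ⟩
    S * (2 ^ N * (c * (2 + k)))
      ≡⟨ total-const _ ⟨
    total (λ _ _ → c * (2 + k))
      ≤⟨ ∑-mono (allFin S) (λ ω → ∑-mono (cube N) (λ x →
           tangent (hits (guess ω x) x) (misses (guess ω x) x) (9 * k) k
             (trans (hits+misses (guess ω x) x) (trans N≡10k (+-comm k (9 * k)))))) ⟩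
    total (λ ω x → 2 * 2 ^ hits (guess ω x) x + c * misses (guess ω x) x)
      ≡⟨ total-+ _ _ ⟩
    total (λ ω x → 2 * 2 ^ hits (guess ω x) x) + total (λ ω x → c * misses (guess ω x) x)
      ≡⟨ cong₂ _+_ (total-*ˡ 2 _) (total-*ˡ c _) ⟩
    2 * X + c * total (λ ω x → misses (guess ω x) x)
      ≤⟨ +-monoʳ-≤ (2 * X) (*-monoʳ-≤ c total-misses) ⟩
    2 * X + c * (S * (2 ^ N * k)) ∎))
    where
    rearrange : ∀ S K c k → 2 * (S * (K * c)) + c * (S * (K * k)) ≡ S * (K * (c * (2 + k)))
    rearrange = solve-∀

  upper : X ≤ S * (2 ^ s * 3 ^ N)
  upper = begin
    ∑ (allFin S) (λ ω → ∑ (cube N) (λ x → 2 ^ hits (guess ω x) x))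
      -- The message sent depends on `x`; summing over all messages removes this dependence, so that
      -- the sums can be exchanged.
      ≤⟨ ∑-mono (allFin S) (λ ω → ∑-mono (cube N) (λ x →
           term≤∑ (λ μ → 2 ^ hits (decode ω μ) x) (∈-cube (encode ω x)))) ⟩
    ∑ (allFin S) (λ ω → ∑ (cube N) (λ x → ∑ (cube s) (λ μ → 2 ^ hits (decode ω μ) x)))
      ≡⟨ ∑-cong (allFin S) (λ ω → trans (∑-swap (cube N) (cube s) _)
           (trans (∑-cong (cube s) (λ μ → ∑2^hits N (decode ω μ)))
             (trans (∑-const (cube s) (3 ^ N)) (cong (_* 3 ^ N) (∣cube∣ s))))) ⟩
    ∑ (allFin S) (λ ω → 2 ^ s * 3 ^ N)
      ≡⟨ trans (∑-const (allFin S) _) (cong (_* (2 ^ s * 3 ^ N)) (∣allFin∣ S)) ⟩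
    S * (2 ^ s * 3 ^ N) ∎

  -- Cancelling the seeds from `lower` and `upper` leaves `2 ^ N * c`, whose exponent is 10k + 9k.
  2^19k≤ : 2 ^ (19 * k) ≤ 2 ^ s * 3 ^ (10 * k)
  2^19k≤ = begin
    2 ^ (19 * k)               ≡⟨ cong (2 ^_) (*-distribʳ-+ k 10 9) ⟩
    2 ^ (10 * k + 9 * k)       ≡⟨ ^-distribˡ-+-* 2 (10 * k) (9 * k) ⟩
    2 ^ (10 * k) * 2 ^ (9 * k) ≤⟨ subst (λ N → 2 ^ N * c ≤ 2 ^ s * 3 ^ N) N≡10k (*-cancelˡ-≤ S (≤-trans lower upper)) ⟩
    2 ^ s * 3 ^ (10 * k)       ∎

  2^3k≤2^s : 2 ^ (3 * k) ≤ 2 ^ s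
  2^3k≤2^s = *-cancelʳ-≤ _ _ (3 ^ (10 * k)) {{m^n≢0 3 (10 * k)}} (begin
    2 ^ (3 * k) * 3 ^ (10 * k)   ≡⟨ cong₂ _*_ (^-*-assoc 2 3 k) (^-*-assoc 3 10 k) ⟨
    (2 ^ 3) ^ k * (3 ^ 10) ^ k   ≡⟨ ^-distribʳ-* k (2 ^ 3) (3 ^ 10) ⟨
    (2 ^ 3 * 3 ^ 10) ^ k         ≤⟨ ^-monoˡ-≤ k (from-yes (2 ^ 3 * 3 ^ 10 ≤? 2 ^ 19)) ⟩
    (2 ^ 19) ^ k                 ≡⟨ ^-*-assoc 2 19 k ⟩
    2 ^ (19 * k)                 ≤⟨ 2^19k≤ ⟩
    2 ^ s * 3 ^ (10 * k)         ∎)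

-- Graphs given by lists of signed edges.

unique-pairs : ∀ n → Unique (pairs n)
unique-pairs n = Unique.filter⁺ _ (Unique.cartesianProduct⁺ (Unique.allFin⁺ n) (Unique.allFin⁺ n))

∈-pairs⁺ : ∀ {u v : Fin n} → u Fin.< v → (u , v) ∈ pairs n
∈-pairs⁺ {u = u} {v} = ∈-filter⁺ _ (∈-cartesianProduct⁺ (∈-allFin u) (∈-allFin v))

∈-pairs⁻ : ∀ {u v : Fin n} → (u , v) ∈ pairs n → u Fin.< v
∈-pairs⁻ {n} uv∈ = proj₂ (∈-filter⁻ (λ (u , v) → u Fin.<? v) {xs = cartesianProduct (allFin n) (allFin n)} uv∈)

endpoints : Edge n → Fin n × Fin n
endpoints (u , v , _) = u , v

negative? : Decidable {A = Edge n} (λ (_ , _ , w) → w ℤ.< 0ℤ)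
negative? (_ , _ , w) = w ℤ.<? 0ℤ

-- `ordered` matches the increasing pairs of `pairs`, and `distinct` compares endpoints only, so
-- that no pair carries two weights.
record SignedEdges (es : List (Edge n)) : Set where
  field
    ordered  : All (λ (u , v , _) → u Fin.< v) es
    signed   : All (λ (_ , _ , w) → w ≡ 1ℤ ⊎ w ≡ -1ℤ) es
    distinct : Unique (map endpoints es)

-- Abstract, because `with joins? …` finds nothing to abstract in a goal where
-- it has been unfolded.
abstract
  joins? : ∀ (u v a b : Fin n) → Dec ((u ≡ a × v ≡ b) ⊎ (u ≡ b × v ≡ a))
  joins? u v a b = (u Fin.≟ a ×-dec v Fin.≟ b) ⊎-dec (u Fin.≟ b ×-dec v Fin.≟ a)

-- Endpoints are matched in either order to make the weight symmetric; a pair matching no entry gets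
-- 0, the weight of a non-edge.
weightIn : List (Edge n) → Fin n → Fin n → ℤ
weightIn []                 u v = 0ℤ
weightIn ((a , b , w) ∷ es) u v = if does (joins? u v a b) then w else weightIn es u v

weightIn-sym : ∀ (es : List (Edge n)) u v → weightIn es u v ≡ weightIn es v u
weightIn-sym []                 u v = refl
weightIn-sym ((a , b , w) ∷ es) u v with joins? u v a b | joins? v u a b
... | yes _                    | yes _ = refl
... | no  _                    | no  _ = weightIn-sym es u v
... | yes (inj₁ (refl , refl)) | no ¬j = contradiction (inj₂ (refl , refl)) ¬j
... | yes (inj₂ (refl , refl)) | no ¬j = contradiction (inj₁ (refl , refl)) ¬j
... | no ¬j | yes (inj₁ (refl , refl)) = contradiction (inj₂ (refl , refl)) ¬j
... | no ¬j | yes (inj₂ (refl , refl)) = contradiction (inj₁ (refl , refl)) ¬j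

fromEdges : List (Edge n) → Graph n
fromEdges es = record { weight = weightIn es ; symmetric = weightIn-sym es }

weightIn-∈ : ∀ {es : List (Edge n)} {u v w} → All (λ (u , v , _) → u Fin.< v) es →
             Unique (map endpoints es) → (u , v , w) ∈ es → weightIn es u v ≡ w
weightIn-∈ {es = (a , b , w) ∷ es} _ _ (here refl) with joins? a b a b
... | yes _ = refl
... | no ¬j = contradiction (inj₁ (refl , refl)) ¬j
weightIn-∈ {es = (a , b , w) ∷ es} {u} {v} (a<b ∷ ord) (fresh ∷ uniq) (there e∈) with joins? u v a b
... | yes (inj₁ (refl , refl)) = contradiction refl (All.lookup fresh (∈-map⁺ endpoints e∈))
... | yes (inj₂ (refl , refl)) = contradiction (All.lookup ord e∈) (Fin.<-asym a<b)
... | no _                     = weightIn-∈ ord uniq e∈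

-- A nonzero weight is not the default, so it comes from some entry; the ordering excludes a
-- reversed match.
∈-weightIn : ∀ (es : List (Edge n)) {u v} → All (λ (u , v , _) → u Fin.< v) es → u Fin.< v →
             weightIn es u v ≢ 0ℤ → (u , v , weightIn es u v) ∈ es
∈-weightIn []                 _           _   w≢0 = contradiction refl w≢0
∈-weightIn ((a , b , w) ∷ es) {u} {v} (a<b ∷ ord) u<v w≢0 with joins? u v a b
... | yes (inj₁ (refl , refl)) = here refl
... | yes (inj₂ (refl , refl)) = contradiction u<v (Fin.<-asym a<b)
... | no _                     = there (∈-weightIn es ord u<v w≢0)

weightIn∈W : ∀ {es : List (Edge n)} → All (λ (_ , _ , w) → w ≡ 1ℤ ⊎ w ≡ -1ℤ) es →
             WeightsIn (-1ℤ ∷ 0ℤ ∷ 1ℤ ∷ []) (fromEdges es)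
weightIn∈W []                   u v = there (here refl)
weightIn∈W {es = (a , b , _) ∷ _} (w∈ ∷ sgn) u v with joins? u v a b | w∈
... | no  _ | _         = weightIn∈W sgn u v
... | yes _ | inj₁ refl = there (there (here refl))
... | yes _ | inj₂ refl = here refl

sum≡0 : ∀ {A : Set} {f : A → ℕ} {xs x} → sum (map f xs) ≡ 0 → x ∈ xs → f x ≡ 0
sum≡0 {f = f} {x ∷ _} Σ≡0 (here refl) = m+n≡0⇒m≡0 (f x) Σ≡0
sum≡0 {f = f} {x ∷ _} Σ≡0 (there y∈)  = sum≡0 (m+n≡0⇒n≡0 (f x) Σ≡0) y∈

-- Signed edge lists as streams, and clusterings without disagreement.

module _ {es : List (Edge n)} (simple : SignedEdges es) where
  open SignedEdges simple

  private
    G : Graph n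
    G = fromEdges es

  weight≢0 : ∀ {u v w} → (u , v , w) ∈ es → weight G u v ≢ 0ℤ
  weight≢0 e∈ w≡0 with trans (sym (weightIn-∈ ordered distinct e∈)) w≡0 | All.lookup signed e∈
  ... | refl | inj₁ ()
  ... | refl | inj₂ ()

  -- Both lists are free of repetitions, so having the same elements makes them permutations of each
  -- other.
  fromEdges-streams : es Streams G
  fromEdges-streams = ∼bag⇒↭ (unique∧set⇒bag (Unique.map⁻ distinct) unique-edges (mk⇔ to from))
    where
    nonzero? : Decidable (λ (u , v) → weight G u v ≢ 0ℤ)
    nonzero? (u , v) = ¬? (weight G u v ℤ.≟ 0ℤ)
    unique-edges : Unique (edges G)
    unique-edges = Unique.map⁺ (λ eq → cong endpoints eq) (Unique.filter⁺ nonzero? (unique-pairs n))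
    to : ∀ {e} → e ∈ es → e ∈ edges G
    to {u , v , w} e∈ = subst (λ w → (u , v , w) ∈ edges G) (weightIn-∈ ordered distinct e∈)
      (∈-map⁺ _ (∈-filter⁺ nonzero? (∈-pairs⁺ (All.lookup ordered e∈)) (weight≢0 e∈)))
    from : ∀ {e} → e ∈ edges G → e ∈ es
    from e∈ with (u , v) , uv∈ , refl , w≢0 ← ∈-map∘filter⁻ (λ (u , v) → u , v , weight G u v) nonzero? {xs = pairs n} e∈ =
      ∈-weightIn es ordered (∈-pairs⁻ uv∈) w≢0

  -- Lets the budget of negative edges be checked on the stream itself.
  length-E⁻ : length (E⁻ G) ≡ length (filter negative? es)
  length-E⁻ = trans (↭-length (∼bag⇒↭ (unique∧set⇒bag (Unique.filter⁺ _ (unique-pairs n)) unique-neg (mk⇔ to from))))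
                    (length-map endpoints (filter negative? es))
    where
    neg? : Decidable (λ (u , v) → weight G u v ℤ.< 0ℤ)
    neg? (u , v) = weight G u v ℤ.<? 0ℤ
    unique-neg : Unique (map endpoints (filter negative? es))
    unique-neg = AllPairs.map⁺ (AllPairs.filter⁺ negative? (AllPairs.map⁻ distinct))
    to : ∀ {p} → p ∈ E⁻ G → p ∈ map endpoints (filter negative? es)
    to {u , v} p∈ with uv∈ , w<0 ← ∈-filter⁻ neg? {xs = pairs n} p∈ =
      ∈-map∘filter⁺ endpoints negative? (_ , ∈-weightIn es ordered (∈-pairs⁻ uv∈) (ℤ.<⇒≢ w<0) , refl , w<0)
    from : ∀ {p} → p ∈ map endpoints (filter negative? es) → p ∈ E⁻ G
    from p∈ with (u , v , w) , e∈ , refl , w<0 ← ∈-map∘filter⁻ endpoints negative? {xs = es} p∈ =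
      ∈-filter⁺ neg? (∈-pairs⁺ (All.lookup ordered e∈))
        (subst (ℤ._< 0ℤ) (sym (weightIn-∈ ordered distinct e∈)) w<0)

  -- A sum of naturals is 0 only if every summand is, whereas a disagreeing edge would contribute a
  -- nonzero absolute weight.
  agreement : ∀ 𝒞 → disagree G 𝒞 ≡ 0 → ∀ {u v w} → (u , v , w) ∈ es → ¬ Disagrees G 𝒞 (u , v)
  agreement 𝒞 none {u} {v} e∈ bad = weight≢0 e∈ (ℤ.∣i∣≡0⇒i≡0
    (sum≡0 none (∈-filter⁺ (disagrees? G 𝒞) (∈-pairs⁺ (All.lookup ordered e∈)) bad)))

  positive⇒together : ∀ 𝒞 → disagree G 𝒞 ≡ 0 → ∀ {u v} → (u , v , 1ℤ) ∈ es → Clustering._~_ 𝒞 u v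
  positive⇒together 𝒞 none {u} {v} e∈ = decidable-stable (Clustering._~?_ 𝒞 u v)
    λ u≁v → agreement 𝒞 none e∈
      (inj₁ (subst (0ℤ ℤ.<_) (sym (weightIn-∈ ordered distinct e∈)) (ℤ.+<+ (s≤s z≤n)) , u≁v))

  negative⇒apart : ∀ 𝒞 → disagree G 𝒞 ≡ 0 → ∀ {u v} → (u , v , -1ℤ) ∈ es → ¬ Clustering._~_ 𝒞 u v
  negative⇒apart 𝒞 none e∈ u~v = agreement 𝒞 none e∈
    (inj₂ (subst (ℤ._< 0ℤ) (sym (weightIn-∈ ordered distinct e∈)) ℤ.-<+ , u~v))

  -- For either sign exactly one of the last two edges is negative, and the two positive edges force
  -- its endpoints into one cluster by transitivity.
  frustrated-triangle : ∀ σ {u v w} → (u , v , 1ℤ) ∈ es → (u , w , Sign.opposite σ ◃ 1) ∈ es →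
                        (v , w , σ ◃ 1) ∈ es → ¬ MinDisagree≡ G 0
  frustrated-triangle σ uv uw vw ((𝒞 , none) , _) with σ
  ... | Sign.+ = negative⇒apart 𝒞 none uw
                   (~.trans (positive⇒together 𝒞 none uv) (positive⇒together 𝒞 none vw))
    where module ~ = IsDecEquivalence (Clustering.isDecEquivalence 𝒞)
  ... | Sign.- = negative⇒apart 𝒞 none vw
                   (~.trans (~.sym (positive⇒together 𝒞 none uv)) (positive⇒together 𝒞 none uw))
    where module ~ = IsDecEquivalence (Clustering.isDecEquivalence 𝒞)

  -- The witness has the cluster K and singletons.
  one-cluster : ∀ (K : List (Fin n)) {r} → r ∈ K →
    (∀ {u v} → (u , v ,  1ℤ) ∈ es → u ∈ K × v ∈ K) →
    (∀ {u v} → (u , v , -1ℤ) ∈ es → ¬ (u ∈ K × v ∈ K)) →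
    MinDisagree≡ G 0
  one-cluster K {r} r∈K inside across = (𝒞 , cong (sum ∘ map _) (filter-none _ (All.tabulate agrees))) , λ _ → z≤n
    where
    open DecMembership (Fin._≟_ {n}) using (_∈?_)

    -- Clusters are the fibres of a map to representatives, which makes the equivalence laws
    -- automatic.
    rep : Fin n → Fin n
    rep u with u ∈? K
    ... | yes _ = r
    ... | no  _ = u

    𝒞 : Clustering n
    𝒞 = record { _~_ = λ u v → rep u ≡ rep v ; isDecEquivalence = On.isDecEquivalence rep (isDecEquivalence Fin._≟_) }

    merged : ∀ {u v} → u ∈ K × v ∈ K → rep u ≡ rep v
    merged {u} {v} (u∈K , v∈K) with u ∈? K | v ∈? K
    ... | yes _   | yes _   = refl
    ... | no  u∉K | _       = contradiction u∈K u∉K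
    ... | _       | no  v∉K = contradiction v∈K v∉K

    -- Since `r` lies in `K`, a node outside `K` never shares the representative of `K`.
    separated : ∀ {u v} → u ≢ v → ¬ (u ∈ K × v ∈ K) → rep u ≢ rep v
    separated {u} {v} u≢v ¬K with u ∈? K | v ∈? K
    ... | yes u∈K | yes v∈K = contradiction (u∈K , v∈K) ¬K
    ... | yes _   | no  v∉K = λ { refl → v∉K r∈K }
    ... | no  u∉K | yes _   = λ { refl → u∉K r∈K }
    ... | no  _   | no  _   = u≢v

    entry : ∀ {u v} → u Fin.< v → weight G u v ≢ 0ℤ →
            ((u , v , 1ℤ) ∈ es × weight G u v ≡ 1ℤ) ⊎ ((u , v , -1ℤ) ∈ es × weight G u v ≡ -1ℤ)
    entry {u} {v} u<v w≢0 = Sum.map at at (All.lookup signed e∈)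
      where
      e∈ : (u , v , weight G u v) ∈ es
      e∈ = ∈-weightIn es ordered u<v w≢0
      at : ∀ {w} → weight G u v ≡ w → (u , v , w) ∈ es × weight G u v ≡ w
      at eq = subst (λ w → (u , v , w) ∈ es) eq e∈ , eq

    agrees : ∀ {p} → p ∈ pairs n → ¬ Disagrees G 𝒞 p
    agrees p∈ (inj₁ (0<w , u≁v)) with entry (∈-pairs⁻ p∈) (≢-sym (ℤ.<⇒≢ 0<w))
    ... | inj₁ (e∈ , _)    = u≁v (merged (inside e∈))
    ... | inj₂ (_  , w≡-1) with () ← subst (0ℤ ℤ.<_) w≡-1 0<w
    agrees p∈ (inj₂ (w<0 , u~v)) with entry (∈-pairs⁻ p∈) (ℤ.<⇒≢ w<0)
    ... | inj₁ (_  , w≡1) with ℤ.+<+ () ← subst (ℤ._< 0ℤ) w≡1 w<0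
    ... | inj₂ (e∈ , _)   = separated (Fin.<⇒≢ (∈-pairs⁻ p∈)) (across e∈) u~v

-- The INDEX gadget.

bit : Bool → Fin 2
bit false = zero
bit true  = suc zero

bit-injective : ∀ {β γ} → bit β ≡ bit γ → β ≡ γ
bit-injective {false} {false} _ = refl
bit-injective {true}  {true}  _ = refl

signed◃ : ∀ σ → (σ ◃ 1 ≡ 1ℤ) ⊎ (σ ◃ 1 ≡ -1ℤ)
signed◃ Sign.+ = inj₁ refl
signed◃ Sign.- = inj₂ refl

-- The second part starts at the time at which the first one ended, because `step` sees the clock.
process-++ : ∀ {n s} (D : Deterministic n s) k (xs ys : List (Edge n)) μ →
             let open Deterministic D in
             process k (xs ++ ys) μ ≡ process (k + length xs) ys (process k xs μ)
process-++ D k []       ys μ = cong (λ k → Deterministic.process D k ys μ) (sym (+-identityʳ k))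
process-++ D k (x ∷ xs) ys μ = trans (process-++ D (suc k) xs ys (step k x μ))
  (cong (λ k′ → process k′ ys (process k (x ∷ xs) μ)) (sym (+-suc k (length xs))))
  where open Deterministic D

-- Clears denominators, turning a probability into a count of seeds.
9/10≤h/S⇒ : ∀ h S .{{_ : NonZero S}} → ℤ.+ 9 ℚᵘ./ 10 ℚᵘ.≤ ℤ.+ h ℚᵘ./ S → 9 * S ≤ 10 * h
9/10≤h/S⇒ h S@(suc _) (ℚᵘ.*≤* 9S≤h10) = subst (9 * S ≤_) (*-comm h 10)
  (ℤ.drop‿+≤+ (subst₂ ℤ._≤_ (sym (ℤ.pos-* 9 S)) (sym (ℤ.pos-* h 10)) 9S≤h10))

Pr⇒hits : ∀ {n s} (A : Randomized n s) xs β → let open Randomized A in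
          ℤ.+ 9 ℚᵘ./ 10 ℚᵘ.≤ Pr[ A on xs outputs β ] →
          9 * seeds ≤ 10 * ∑ (allFin seeds) (λ ω → hit (Deterministic.run (deterministic ω) xs) β)
Pr⇒hits A xs β Pr≥ = subst (λ h → 9 * seeds ≤ 10 * h) (length-filter-≟ (allFin seeds) _ β)
  (9/10≤h/S⇒ _ seeds {{seeds≢0}} Pr≥)
  where open Randomized A

-- One of the two nodes b j false, b j true is used whatever the bit is, so Alice's
-- stream has a fixed length and Bob knows the time at which his own starts.
module Gadget {n p q : ℕ} (room : suc (p + q * 2) ≤ n) (σ : Sign) where

  -- The nodes are laid out as `w`, then all `a i`, then the pairs `b j false`, `b j true`, so that
  -- every edge below runs in increasing order.
  w : Fin n
  w = inject≤ zero room

  a : Fin p → Fin n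
  a i = inject≤ (suc (i ↑ˡ (q * 2))) room

  b : Fin q → Bool → Fin n
  b j β = inject≤ (suc (p ↑ʳ combine j (bit β))) room

  w<a : ∀ i → w Fin.< a i
  w<a i rewrite Fin.toℕ-inject≤ {n = n} (zero {p + q * 2}) room
              | Fin.toℕ-inject≤ (suc (i ↑ˡ (q * 2))) room = s≤s z≤n

  w<b : ∀ j β → w Fin.< b j β
  w<b j β rewrite Fin.toℕ-inject≤ {n = n} (zero {p + q * 2}) room
                | Fin.toℕ-inject≤ (suc (p ↑ʳ combine j (bit β))) room = s≤s z≤n

  a<b : ∀ i j β → a i Fin.< b j β
  a<b i j β rewrite Fin.toℕ-inject≤ (suc (i ↑ˡ (q * 2))) room
                  | Fin.toℕ-inject≤ (suc (p ↑ʳ combine j (bit β))) room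
                  | Fin.toℕ-↑ˡ i (q * 2) | Fin.toℕ-↑ʳ p (combine j (bit β)) =
    s≤s (≤-trans (Fin.toℕ<n i) (m≤m+n p _))

  a-injective : ∀ {i i′} → a i ≡ a i′ → i ≡ i′
  a-injective {i} {i′} eq = Fin.↑ˡ-injective (q * 2) i i′ (Fin.suc-injective (Fin.inject≤-injective room room _ _ eq))

  b-injective : ∀ {j j′ β β′} → b j β ≡ b j′ β′ → j ≡ j′ × β ≡ β′
  b-injective {j} {j′} {β} {β′} eq
    with j≡ , β≡ ← Fin.combine-injective j (bit β) j′ (bit β′)
      (Fin.↑ʳ-injective p _ _ (Fin.suc-injective (Fin.inject≤-injective room room _ _ eq))) = j≡ , bit-injective β≡

  row : Fin (p * q) → Fin p
  row t = proj₁ (remQuot {p} q t)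

  col : Fin (p * q) → Fin q
  col t = proj₂ (remQuot {p} q t)

  row-col-injective : ∀ {t t′} → row t ≡ row t′ → col t ≡ col t′ → t ≡ t′
  row-col-injective {t} {t′} r c = trans (sym (Fin.combine-remQuot {p} q t))
    (trans (cong₂ combine r c) (Fin.combine-remQuot {p} q t′))

  aliceEdge : Vec Bool (p * q) → Fin (p * q) → Edge n
  aliceEdge x t = a (row t) , b (col t) (lookup x t) , σ ◃ 1

  alice : Vec Bool (p * q) → List (Edge n)
  alice x = tabulate (aliceEdge x)

  bob : Fin (p * q) → List (Edge n)
  bob t = (w , a (row t) , 1ℤ) ∷ (w , b (col t) false , Sign.opposite σ ◃ 1) ∷ []

  stream : Vec Bool (p * q) → Fin (p * q) → List (Edge n)
  stream x t = alice x ++ bob t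

  -- Alice's edges differ in row or column whatever the bits are, and Bob's start at `w`, which lies
  -- below the starting point of each of hers.
  stream-signedEdges : ∀ x t → SignedEdges (stream x t)
  stream-signedEdges x t = record
    { ordered  = All.++⁺ (All.tabulate⁺ (λ t → a<b (row t) (col t) _)) (w<a _ ∷ w<b _ _ ∷ [])
    ; signed   = All.++⁺ (All.tabulate⁺ (λ _ → signed◃ σ)) (inj₁ refl ∷ signed◃ (Sign.opposite σ) ∷ [])
    ; distinct = subst Unique (sym (trans (map-++ endpoints (alice x) (bob t))
                                          (cong (_++ map endpoints (bob t)) (map-tabulate (aliceEdge x) endpoints))))
                   (Unique.++⁺ (Unique.tabulate⁺ alice-distinct)
                     (((Fin.<⇒≢ (a<b _ _ _) ∘ ,-injectiveʳ) ∷ []) ∷ [] ∷ []) disjoint)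
    }
    where
    alice-distinct : ∀ {t t′} → endpoints (aliceEdge x t) ≡ endpoints (aliceEdge x t′) → t ≡ t′
    alice-distinct eq = row-col-injective (a-injective (,-injectiveˡ eq)) (proj₁ (b-injective (,-injectiveʳ eq)))
    disjoint : ∀ {e} → ¬ (e ∈ tabulate (endpoints ∘ aliceEdge x) × e ∈ map endpoints (bob t))
    disjoint (e∈alice , here refl) with _ , eq ← ∈-tabulate⁻ e∈alice = Fin.<⇒≢ (w<a _) (,-injectiveˡ eq)
    disjoint (e∈alice , there (here refl)) with _ , eq ← ∈-tabulate⁻ e∈alice = Fin.<⇒≢ (w<a _) (,-injectiveˡ eq)

  bit-false : ∀ x t → lookup x t ≡ false → ¬ MinDisagree≡ (fromEdges (stream x t)) 0
  bit-false x t xₜ≡false = frustrated-triangle (stream-signedEdges x t) σ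
    (∈-++⁺ʳ (alice x) (here refl)) (∈-++⁺ʳ (alice x) (there (here refl)))
    (∈-++⁺ˡ (subst (λ β → (a (row t) , b (col t) β , σ ◃ 1) ∈ alice x) xₜ≡false (∈-tabulate⁺ t)))

-- For σ = + the only negative edge is Bob's, but all of Alice's edges must then
-- fit into one cluster together with Bob's node w, hence the single row.
Feasible : ℕ → ℕ → ℕ → Sign → Set
Feasible m p q Sign.- = p * q ≤ m
Feasible m p q Sign.+ = 1 ≤ m × p ≡ 1

-- For σ = - only Alice's p * q edges count, as both of Bob's are positive; for σ = + only Bob's
-- second edge is negative.
negatives≤m : ∀ {n m p q} (room : suc (p + q * 2) ≤ n) σ → Feasible m p q σ →
              ∀ x t → let open Gadget {n} {p} {q} room σ in length (filter negative? (stream x t)) ≤ m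
negatives≤m {m = m} {p} {q} room Sign.- pq≤m x t = begin
  length (filter negative? (alice x ++ bob t))  ≡⟨ cong length (filter-++ negative? (alice x) (bob t)) ⟩
  length (filter negative? (alice x) ++ [])     ≡⟨ cong length (++-identityʳ (filter negative? (alice x))) ⟩
  length (filter negative? (alice x))           ≤⟨ length-filter negative? (alice x) ⟩
  length (alice x)                              ≡⟨ length-tabulate (aliceEdge x) ⟩
  p * q                                         ≤⟨ pq≤m ⟩
  m                                             ∎
  where
  open ≤-Reasoning
  open Gadget {_} {p} {q} room Sign.-
negatives≤m {m = m} {p} {q} room Sign.+ (1≤m , _) x t = begin
  length (filter negative? (alice x ++ bob t))                     ≡⟨ cong length (filter-++ negative? (alice x) (bob t)) ⟩
  length (filter negative? (alice x) ++ filter negative? (bob t))  ≡⟨ cong (λ es → length (es ++ filter negative? (bob t))) none ⟩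
  1                                                                ≤⟨ 1≤m ⟩
  m                                                                ∎
  where
  open ≤-Reasoning
  open Gadget {_} {p} {q} room Sign.+
  none : filter negative? (alice x) ≡ []
  none = filter-none negative? (All.tabulate⁺ {f = aliceEdge x} λ { _ (ℤ.+<+ ()) })

-- The cluster contains `w`, `a (row t)` and, for σ = -, the node `b (col t) false`; for σ = +
-- instead every `b` that Alice used. In both cases a negative edge inside it would make bit `t`
-- false.
bit-true : ∀ {n m p q} (room : suc (p + q * 2) ≤ n) σ → Feasible m p q σ →
           ∀ x t → let open Gadget {n} {p} {q} room σ in
           lookup x t ≡ true → MinDisagree≡ (fromEdges (stream x t)) 0
bit-true {p = p} {q} room Sign.- _ x t xₜ≡true =
  one-cluster (stream-signedEdges x t) K (here refl) inside across
  where
  open Gadget {_} {p} {q} room Sign.-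
  K : List (Fin _)
  K = w ∷ a (row t) ∷ b (col t) false ∷ []
  inside : ∀ {u v} → (u , v , 1ℤ) ∈ stream x t → u ∈ K × v ∈ K
  inside e∈ with ∈-++⁻ (alice x) e∈
  ... | inj₁ e∈alice with _ , () ← ∈-tabulate⁻ e∈alice
  ... | inj₂ (here refl) = here refl , there (here refl)
  ... | inj₂ (there (here refl)) = here refl , there (there (here refl))
  across : ∀ {u v} → (u , v , -1ℤ) ∈ stream x t → ¬ (u ∈ K × v ∈ K)
  across e∈ with ∈-++⁻ (alice x) e∈
  ... | inj₂ (there (here ()))
  ... | inj₁ e∈alice with t′ , refl ← ∈-tabulate⁻ e∈alice = λ
    { (here eq , _) → Fin.<⇒≢ (w<a _) (sym eq)
    ; (there (there (here eq)) , _) → Fin.<⇒≢ (a<b _ _ _) eq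
    ; (there (here _) , here eq) → Fin.<⇒≢ (w<b _ _) (sym eq)
    ; (there (here _) , there (here eq)) → Fin.<⇒≢ (a<b _ _ _) (sym eq)
    -- The critical case: this would be Alice's edge for position `t`, ending at the node of a false
    -- bit.
    ; (there (here row≡) , there (there (here b≡))) →
        let col≡ , x≡ = b-injective b≡
            t≡ = row-col-injective (a-injective row≡) col≡
        in contradiction (trans (sym xₜ≡true) (trans (cong (lookup x) (sym t≡)) x≡)) λ ()
    }
bit-true {p = p} {q} room Sign.+ (_ , refl) x t xₜ≡true =
  one-cluster (stream-signedEdges x t) K (here refl) inside across
  where
  open Gadget {_} {p} {q} room Sign.+
  used : Fin (p * q) → Fin _
  used t = b (col t) (lookup x t)
  -- With p = 1 a position is determined by its column alone.
  row-trivial : ∀ t t′ → row t ≡ row t′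
  row-trivial t t′ with row t | row t′
  ... | zero | zero = refl
  K : List (Fin _)
  K = w ∷ a (row t) ∷ tabulate used
  inside : ∀ {u v} → (u , v , 1ℤ) ∈ stream x t → u ∈ K × v ∈ K
  inside e∈ with ∈-++⁻ (alice x) e∈
  ... | inj₁ e∈alice with t′ , refl ← ∈-tabulate⁻ e∈alice =
          there (here (cong a (row-trivial t′ t))) , there (there (∈-tabulate⁺ t′))
  ... | inj₂ (here refl) = here refl , there (here refl)
  ... | inj₂ (there (here ()))
  across : ∀ {u v} → (u , v , -1ℤ) ∈ stream x t → ¬ (u ∈ K × v ∈ K)
  across e∈ (_ , v∈K) with ∈-++⁻ (alice x) e∈
  ... | inj₁ e∈alice with _ , () ← ∈-tabulate⁻ e∈alice
  across e∈ (_ , here eq)         | inj₂ (there (here refl)) = Fin.<⇒≢ (w<b _ _) (sym eq)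
  across e∈ (_ , there (here eq)) | inj₂ (there (here refl)) = Fin.<⇒≢ (a<b _ _ _) (sym eq)
  across e∈ (_ , there (there v∈)) | inj₂ (there (here refl))
    with t′ , eq ← ∈-tabulate⁻ v∈ with col≡ , x≡ ← b-injective eq =
    contradiction (trans (sym xₜ≡true) (trans (cong (lookup x) (row-col-injective (row-trivial t t′) col≡)) (sym x≡))) λ ()

-- Stream algorithms as INDEX protocols.

-- The message is the memory after Alice's edges, and the seed is shared by both players. The
-- decoder resumes at time p * q, the length of Alice's stream.
space-bound : ∀ {n m s p q} k σ → suc (p + q * 2) ≤ n → Feasible m p q σ → p * q ≡ 10 * k →
              (A : Randomized n s) → TestsZeroDisagreement m A → 3 * k ≤ s
space-bound {n} {m} {s} {p} {q} k σ room feasible N≡10k A tests =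
  index-lower-bound k seeds {{seeds≢0}} N≡10k encode decode good
  where
  open Randomized A
  open Gadget {n} {p} {q} room σ
  open ≤-Reasoning

  encode : Fin seeds → Vec Bool (p * q) → Vec Bool s
  encode ω x = process 0 (alice x) init
    where open Deterministic (deterministic ω)

  decode : Fin seeds → Vec Bool s → Fin (p * q) → Bool
  decode ω μ t = output (process (p * q) (bob t) μ)
    where open Deterministic (deterministic ω)

  decode-run : ∀ ω x t → Deterministic.run (deterministic ω) (stream x t) ≡ decode ω (encode ω x) t
  decode-run ω x t = cong output (trans (process-++ (deterministic ω) 0 (alice x) (bob t) init)
    (cong (λ k → process k (bob t) (encode ω x)) (length-tabulate (aliceEdge x))))
    where open Deterministic (deterministic ω)

  correct : ∀ x t → ℤ.+ 9 ℚᵘ./ 10 ℚᵘ.≤ Pr[ A on stream x t outputs lookup x t ]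
  correct x t = go (lookup x t) refl
    where
    G : Graph n
    G = fromEdges (stream x t)
    simple : SignedEdges (stream x t)
    simple = stream-signedEdges x t
    tests-G : _
    tests-G = tests G (weightIn∈W (SignedEdges.signed simple)) (subst (_≤ m) (sym (length-E⁻ simple)) (negatives≤m room σ feasible x t))
                    (stream x t) (fromEdges-streams simple)
    go : ∀ β → lookup x t ≡ β → ℤ.+ 9 ℚᵘ./ 10 ℚᵘ.≤ Pr[ A on stream x t outputs β ]
    go true  xₜ≡true  = proj₁ tests-G (bit-true room σ feasible x t xₜ≡true)
    go false xₜ≡false = proj₂ tests-G (bit-false x t xₜ≡false)

  good : ∀ x t → 9 * seeds ≤ 10 * ∑ (allFin seeds) (λ ω → hit (decode ω (encode ω x) t) (lookup x t))
  good x t = begin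
    9 * seeds ≤⟨ Pr⇒hits A (stream x t) (lookup x t) (correct x t) ⟩
    10 * ∑ (allFin seeds) (λ ω → hit (Deterministic.run (deterministic ω) (stream x t)) (lookup x t))
      ≡⟨ cong (10 *_) (∑-cong (allFin seeds) (λ ω → cong (λ β → hit β (lookup x t)) (decode-run ω x t))) ⟩
    10 * ∑ (allFin seeds) (λ ω → hit (decode ω (encode ω x) t) (lookup x t)) ∎

-- Choice of parameters.

-- Only the quadratic order matters: a gadget with as many rows as columns can carry a number of
-- bits quadratic in the number of nodes.
nC2≤n² : ∀ n → n C 2 ≤ n * n
nC2≤n² zero    = z≤n
nC2≤n² (suc n) = begin
  suc n C 2        ≡⟨ nCk+nC[k+1]≡[n+1]C[k+1] n 1 ⟨
  n C 1 + n C 2    ≡⟨ cong (_+ n C 2) (nC1≡n n) ⟩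
  n + n C 2        ≤⟨ +-monoʳ-≤ n (nC2≤n² n) ⟩
  suc n * n        ≤⟨ *-monoʳ-≤ (suc n) (n≤1+n n) ⟩
  suc n * suc n    ∎
  where open ≤-Reasoning

m<n+[m/n]*n : ∀ m n .{{_ : NonZero n}} → m < n + m / n * n
m<n+[m/n]*n m n = begin-strict
  m                   ≡⟨ m≡m%n+[m/n]*n m n ⟩
  m % n + m / n * n   <⟨ +-monoˡ-< (m / n * n) (m%n<n m n) ⟩
  n + m / n * n       ∎
  where open ≤-Reasoning

-- The number of rows is capped both by the budget m for Alice's p * 10r negative
-- edges and by the available nodes.
dense-parameters : ∀ {n m} r .{{_ : NonZero (10 * r)}} → 40 * r ≤ n → n ≤ 80 * r → n ≤ m → m ≤ n * n →
  ∃[ p ] p ≤ 10 * r × p * (10 * r) ≤ m × m ≤ 80 * (8 * (p * r))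
dense-parameters {n} {m} r 40r≤n n≤80r n≤m m≤n² =
  q ⊓ (m / q) , m⊓n≤m q (m / q) , fits , large (⊓-sel q (m / q))
  where
  open ≤-Reasoning
  q : ℕ
  q = 10 * r
  fits : (q ⊓ (m / q)) * q ≤ m
  fits = ≤-trans (*-monoˡ-≤ q (m⊓n≤n q (m / q))) (m/n*n≤m m q)
  q≤m : q ≤ m
  q≤m = ≤-trans (≤-trans (*-monoˡ-≤ r (from-yes (10 ≤? 40))) 40r≤n) n≤m
  large : q ⊓ (m / q) ≡ q ⊎ q ⊓ (m / q) ≡ m / q → m ≤ 80 * (8 * ((q ⊓ (m / q)) * r))
  -- All 10r rows are used, and their 100r² bits match n² up to a constant. The factor 8 comes from
  -- 80 * 80 = 80 * 8 * 10.
  large (inj₁ p≡q) rewrite p≡q = begin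
    m                     ≤⟨ m≤n² ⟩
    n * n                 ≤⟨ *-mono-≤ n≤80r n≤80r ⟩
    80 * r * (80 * r)     ≡⟨ rearrange 80 10 8 r ⟩
    80 * (8 * (10 * r * r)) ∎
    where
    rearrange : ∀ a b c r → a * r * (b * c * r) ≡ a * (c * (b * r * r))
    rearrange = solve-∀
  -- The budget decides: as q ≤ m, at least one row fits, so rounding down loses at most a factor of
  -- two.
  large (inj₂ p≡m/q) rewrite p≡m/q = begin
    m                          ≤⟨ <⇒≤ (m<n+[m/n]*n m q) ⟩
    q + m / q * q              ≤⟨ +-monoˡ-≤ (m / q * q) (≤-trans (≤-reflexive (sym (*-identityˡ q))) (*-monoˡ-≤ q (m≥n⇒m/n>0 q≤m))) ⟩
    m / q * q + m / q * q      ≡⟨ rearrange (m / q) r ⟩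
    20 * (m / q * r)           ≤⟨ *-monoˡ-≤ (m / q * r) (from-yes (20 ≤? 80)) ⟩
    80 * (m / q * r)           ≤⟨ *-monoʳ-≤ 80 (m≤n*m (m / q * r) 8) ⟩
    80 * (8 * (m / q * r))     ∎
    where
    rearrange : ∀ p r → p * (10 * r) + p * (10 * r) ≡ 20 * (p * r)
    rearrange = solve-∀

theorem32 : ∃[ c ] ∃[ n₀ ] (∀ (n m s : ℕ) → n₀ ≤ n → 1 ≤ m → m ≤ n C 2 →
    (A : Randomized n s) → TestsZeroDisagreement m A →
    n + m ≤ c * s)
-- The factor 2 is for the two summands, 80 for n ≤ 80r and 8 for the dense case; the threshold 40
-- makes r = n / 40 positive.
theorem32 = 2 * 80 * 8 , 40 , λ n m s 40≤n 1≤m m≤nC2 A tests →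
  subst (n + m ≤_) (sym (trans (*-assoc (2 * 80) 8 s) (*-assoc 2 80 (8 * s)))) (bound n m s 40≤n 1≤m m≤nC2 A tests)
  where
  open ≤-Reasoning
  bound : ∀ n m s → 40 ≤ n → 1 ≤ m → m ≤ n C 2 → (A : Randomized n s) → TestsZeroDisagreement m A →
          n + m ≤ 2 * (80 * (8 * s))
  bound n m s 40≤n 1≤m m≤nC2 A tests = by-regime (≤-total m n)
    where
    -- Using 10r columns makes the number of bits a multiple of 10, as `index-lower-bound` asks.
    -- With at most 10r rows, 20r nodes for the columns and `w`, the gadget needs at most 31r nodes.
    r : ℕ
    r = n / 40

    1≤r : 1 ≤ r
    1≤r = m≥n⇒m/n>0 40≤n

    40r≤n : 40 * r ≤ n
    40r≤n = subst (_≤ n) (*-comm r 40) (m/n*n≤m n 40)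

    n≤80r : n ≤ 80 * r
    n≤80r = begin
      n                 ≤⟨ <⇒≤ (m<n+[m/n]*n n 40) ⟩
      40 + r * 40       ≤⟨ +-monoˡ-≤ (r * 40) (*-monoʳ-≤ 40 1≤r) ⟩
      40 * r + r * 40   ≡⟨ rearrange r ⟩
      80 * r            ∎
      where
      rearrange : ∀ r → 40 * r + r * 40 ≡ 80 * r
      rearrange = solve-∀

    room : ∀ {p} → p ≤ 10 * r → suc (p + 10 * r * 2) ≤ n
    room {p} p≤10r = begin
      1 + (p + 10 * r * 2)                ≤⟨ +-mono-≤ 1≤r (+-monoˡ-≤ (10 * r * 2) p≤10r) ⟩
      r + (10 * r + 10 * r * 2)           ≡⟨ rearrange r ⟩
      31 * r                              ≤⟨ *-monoˡ-≤ r (from-yes (31 ≤? 40)) ⟩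
      40 * r                              ≤⟨ 40r≤n ⟩
      n                                   ∎
      where
      rearrange : ∀ r → r + (10 * r + 10 * r * 2) ≡ 31 * r
      rearrange = solve-∀

    k≤s : ∀ {p} k σ → p ≤ 10 * r → Feasible m p (10 * r) σ → p * (10 * r) ≡ 10 * k → k ≤ s
    k≤s {p} k σ p≤10r feasible N≡10k =
      ≤-trans (m≤n*m k 3) (space-bound {p = p} {10 * r} k σ (room p≤10r) feasible N≡10k A tests)

    sum-bound : ∀ {x k} → k ≤ s → n ≤ 80 * x → m ≤ 80 * x → x ≤ 8 * k → n + m ≤ 2 * (80 * (8 * s))
    sum-bound {x} {k} k≤s n≤80x m≤80x x≤8k = begin
      n + m                     ≤⟨ +-mono-≤ n≤80x m≤80x ⟩
      80 * x + 80 * x           ≡⟨ cong (80 * x +_) (+-identityʳ (80 * x)) ⟨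
      2 * (80 * x)              ≤⟨ *-monoʳ-≤ 2 (*-monoʳ-≤ 80 (≤-trans x≤8k (*-monoʳ-≤ 8 k≤s))) ⟩
      2 * (80 * (8 * s))        ∎

    by-regime : m ≤ n ⊎ n ≤ m → n + m ≤ 2 * (80 * (8 * s))
    -- Here n dominates, so a single row of 10r bits with one negative edge suffices.
    by-regime (inj₁ m≤n) = sum-bound {r} {r}
      (k≤s {1} r Sign.+ (≤-trans 1≤r (m≤n*m r 10)) (1≤m , refl) (*-identityˡ (10 * r)))
      n≤80r (≤-trans m≤n n≤80r) (m≤n*m r 8)
    -- Here m dominates, and Alice's edges are the negative ones.
    by-regime (inj₂ n≤m) =
      let instance _ = >-nonZero (≤-trans 1≤r (m≤n*m r 10))
          p , p≤10r , fits , large = dense-parameters r 40r≤n n≤80r n≤m (≤-trans m≤nC2 (nC2≤n² n))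
      in sum-bound {8 * (p * r)} {p * r} (k≤s {p} (p * r) Sign.- p≤10r fits (rearrange p r)) (≤-trans n≤m large) large ≤-refl
      where
      rearrange : ∀ p r → p * (10 * r) ≡ 10 * (p * r)
      rearrange = solve-∀
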